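{- Let $p$ be an odd prime, $a\in\mathbb{Z}_p$, and suppose $\langle a\rangle_p$ is odd. Then $$\sum_{k=0}^{p-1}\binom ak^2(-1)^k\equiv (-1)^{\frac{p-\langle a\rangle_p}{2}-1}\frac{2(a-\langle a\rangle_p)}{a\binom{p-\langle a\rangle_p}{(p-\langle a\rangle_p)/2}}\pmod{p^2}.$$
   Context: $\mathbb{Z}_p$ denotes the set of rational numbers whose denominator is not divisible by $p$; congruences are taken in $\mathbb{Z}_p$. For $a\in\mathbb{Z}_p$, $\langle a\rangle_p$ is the unique integer in $\{0,1,\dots,p-1\}$ with $a\equiv\langle a\rangle_p\pmod p$. The general binomial coefficient is $\binom a0=1$, $\binom ak=a(a-1)\cdots(a-k+1)/k!$ for $k\ge1$. -}

module Defs where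

open import Data.Nat as ℕ using (ℕ; zero; suc; _∸_)
open import Data.Nat.Divisibility as ℕD using ()
open import Data.Nat.Combinatorics using (_C_)
open import Data.Nat.Base using (_!)
open import Data.Integer.Base as ℤ using (ℤ; +_)
open import Data.Rational.Base as ℚ using (ℚ; 0ℚ; 1ℚ; _+_; _*_; _-_; -_; _÷_)
open import Data.Rational.Properties using (_≟_)
open import Data.Product using (Σ; _×_)
open import Relation.Binary.PropositionalEquality using (_≡_)
open import Relation.Nullary using (¬_; yes; no)

ℕ→ℚ : ℕ → ℚ
ℕ→ℚ n = (+ n) ℚ./ 1

-- total division on ℚ (x / 0 := 0); only ever used with nonzero divisors
_div_ : ℚ → ℚ → ℚ
x div y with y ≟ 0ℚ
... | yes _ = 0ℚ
... | no y≢0 = _÷_ x y {{ℚ.≢-nonZero y≢0}}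

InZp : ℕ → ℚ → Set
InZp p x = ¬ (p ℕD.∣ ℚ.denominatorℕ x)

Cong : (p : ℕ) → ℚ → ℚ → ℚ → Set
Cong p m x y = Σ ℚ (λ z → InZp p z × (x - y ≡ m * z))

sgn : ℕ → ℚ
sgn zero = 1ℚ
sgn (suc k) = - sgn k

falling : ℚ → ℕ → ℚ
falling a zero = 1ℚ
falling a (suc k) = falling a k * (a - ℕ→ℚ k)

binom : ℚ → ℕ → ℚ
binom a k = falling a k div ℕ→ℚ (k !)

sumTo : ℕ → (ℕ → ℚ) → ℚ
sumTo zero f = 0ℚ
sumTo (suc n) f = sumTo n f + f n

module Submission where

-- Write S(a) for the sum, p − ⟨a⟩ₚ = 2m and a = p s − 2m with s ∈ ℤₚ. Zeilberger's
-- algorithm gives b((b + 1) S(b + 1) + 4 b S(b − 1)) = ∓ C(b, p−1)² q(b) with a quadratic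
-- polynomial q. If p ∣ C(b, p−1), the right-hand side vanishes mod p², and the recurrence
-- a S(a) ≡ −4 (a − 1) S(a − 2) is, up to terms killed by the factor p in 2(a − ⟨a⟩ₚ) = 2p(s − 1),
-- the one satisfied by (−1)^(m−1) 2p(s − 1) / (a C(2m, m)); so the congruence propagates from m
-- to m + 1. It starts at m = 1, where b = p s − 1: there C(b, k) ≡ (−1)^k and S(p s) ≡ 1 mod p,
-- which suffices because q(b) and b + 1 are both divisible by p.

open import Defs
open import Data.Nat using (ℕ; zero; suc; _<_; _≤_; _∸_; _/_; _^_; s≤s)
import Data.Nat as ℕ
import Data.Nat.Coprimality as Coprimality
import Data.Nat.Properties as ℕP
open import Data.Nat.Combinatorics using (_C_; nCk+nC[k+1]≡[n+1]C[k+1])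
open import Data.Nat.Divisibility using (_∣_; _∣0; divides; ∣-trans; ∣⇒≤; ∣1⇒≡1)
open import Data.Nat.DivMod using (m*n/n≡m)
open import Data.Nat.Primality using (Prime; euclidsLemma; ¬prime[0]; ¬prime[1])
open import Data.Nat.Solver using (module +-*-Solver)
open import Data.Integer.Base as ℤ using (ℤ; +_; -[1+_])
import Data.Integer.Divisibility.Signed as ℤD
import Data.Integer.Properties as ℤP
open import Data.Rational.Base as ℚ using (ℚ; mkℚ; 0ℚ; 1ℚ; _+_; _*_; _-_; -_; toℚᵘ; ↥_; ↧ₙ_)
import Data.Rational.Properties as ℚP
open import Data.Rational.Unnormalised.Base as ℚᵘ using (mkℚᵘ; *≡*)
import Data.Rational.Unnormalised.Properties as ℚᵘP
open import Data.List.Base using ([]; _∷_)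
open import Data.Maybe.Base using (Maybe; just; nothing)
open import Data.Product using (Σ; ∃; _×_; _,_)
open import Data.Sum using (_⊎_; inj₁; inj₂)
open import Function using (_∘_)
open import Level using (0ℓ)
open import Relation.Binary.PropositionalEquality
open import Relation.Nullary using (¬_; yes; no; contradiction)
open import Tactic.RingSolver using (solve)
open import Tactic.RingSolver.Core.AlmostCommutativeRing using (AlmostCommutativeRing; fromCommutativeRing)

open ≡-Reasoning

-- Equations in ℚ by the ring solver, modulo known equations.

ℚ-ring : AlmostCommutativeRing 0ℓ 0ℓ
ℚ-ring = fromCommutativeRing ℚP.+-*-commutativeRing isZero?
  where
  isZero? : (x : ℚ) → Maybe (0ℚ ≡ x)
  isZero? x with 0ℚ ℚP.≟ x
  ... | yes 0≡x = just 0≡x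
  ... | no  _   = nothing

-- An equation is proved by exhibiting the difference of its sides as an
-- explicit combination of the differences of the sides of known equations.
combine₁ : ∀ {x y l r} c → l ≡ r → x ≡ y + c * (l - r) → x ≡ y
combine₁ {y = y} {l} c refl e = trans e (solve (y ∷ l ∷ c ∷ []) ℚ-ring)

combine₂ : ∀ {x y l₁ r₁ l₂ r₂} c₁ c₂ → l₁ ≡ r₁ → l₂ ≡ r₂ →
  x ≡ y + c₁ * (l₁ - r₁) + c₂ * (l₂ - r₂) → x ≡ y
combine₂ c₁ c₂ e₁ e₂ e = combine₁ c₁ e₁ (combine₁ c₂ e₂ e)

combine₃ : ∀ {x y l₁ r₁ l₂ r₂ l₃ r₃} c₁ c₂ c₃ → l₁ ≡ r₁ → l₂ ≡ r₂ → l₃ ≡ r₃ →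
  x ≡ y + c₁ * (l₁ - r₁) + c₂ * (l₂ - r₂) + c₃ * (l₃ - r₃) → x ≡ y
combine₃ c₁ c₂ c₃ e₁ e₂ e₃ e = combine₂ c₁ c₂ e₁ e₂ (combine₁ c₃ e₃ e)

minuend : ∀ x y {z} → x - y ≡ z → x ≡ y + z
minuend x y refl = solve (x ∷ y ∷ []) ℚ-ring

-- Integers and natural numbers inside ℚ.

ℤ→ℚ : ℤ → ℚ
ℤ→ℚ n = n ℚ./ 1

-- Unnormalised fractions add and multiply without reduction to lowest terms, so the homomorphism
-- laws for + and * below are checked there.
toℚᵘ-ℤ→ℚ : ∀ n → toℚᵘ (ℤ→ℚ n) ℚᵘ.≃ mkℚᵘ n 0
toℚᵘ-ℤ→ℚ n = ℚP.toℚᵘ-fromℚᵘ (mkℚᵘ n 0)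

ℤ→ℚ-+ : ∀ m n → ℤ→ℚ (m ℤ.+ n) ≡ ℤ→ℚ m + ℤ→ℚ n
ℤ→ℚ-+ m n = ℚP.toℚᵘ-injective (ℚᵘP.≃-trans (toℚᵘ-ℤ→ℚ (m ℤ.+ n)) (ℚᵘP.≃-trans
  (*≡* (cong (ℤ._* + 1) (sym (cong₂ ℤ._+_ (ℤP.*-identityʳ m) (ℤP.*-identityʳ n)))))
  (ℚᵘP.≃-sym (ℚᵘP.≃-trans (ℚP.toℚᵘ-homo-+ (ℤ→ℚ m) (ℤ→ℚ n))
    (ℚᵘP.+-cong (toℚᵘ-ℤ→ℚ m) (toℚᵘ-ℤ→ℚ n))))))

ℤ→ℚ-* : ∀ m n → ℤ→ℚ (m ℤ.* n) ≡ ℤ→ℚ m * ℤ→ℚ n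
ℤ→ℚ-* m n = ℚP.toℚᵘ-injective (ℚᵘP.≃-trans (toℚᵘ-ℤ→ℚ (m ℤ.* n))
  (ℚᵘP.≃-sym (ℚᵘP.≃-trans (ℚP.toℚᵘ-homo-* (ℤ→ℚ m) (ℤ→ℚ n))
    (ℚᵘP.*-cong (toℚᵘ-ℤ→ℚ m) (toℚᵘ-ℤ→ℚ n)))))

ℤ→ℚ-neg : ∀ n → ℤ→ℚ (ℤ.- n) ≡ - ℤ→ℚ n
ℤ→ℚ-neg (+ zero)  = refl
ℤ→ℚ-neg (+ suc n) = refl
ℤ→ℚ-neg -[1+ n ]  = involutive (ℤ→ℚ (+ suc n))
  where
  involutive : ∀ x → x ≡ - (- x)
  involutive x = solve (x ∷ []) ℚ-ring

ℤ→ℚ-injective : ∀ {m n} → ℤ→ℚ m ≡ ℤ→ℚ n → m ≡ n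
ℤ→ℚ-injective {m} {n} e with ℚP./-injective-≃ (mkℚᵘ m 0) (mkℚᵘ n 0) e
... | *≡* m1≡n1 = trans (sym (ℤP.*-identityʳ m)) (trans m1≡n1 (ℤP.*-identityʳ n))

ℕ→ℚ-+ : ∀ m n → ℕ→ℚ (m ℕ.+ n) ≡ ℕ→ℚ m + ℕ→ℚ n
ℕ→ℚ-+ m n = ℤ→ℚ-+ (+ m) (+ n)

ℕ→ℚ-* : ∀ m n → ℕ→ℚ (m ℕ.* n) ≡ ℕ→ℚ m * ℕ→ℚ n
ℕ→ℚ-* m n = trans (cong ℤ→ℚ (ℤP.pos-* m n)) (ℤ→ℚ-* (+ m) (+ n))

ℕ→ℚ-suc : ∀ n → ℕ→ℚ (suc n) ≡ ℕ→ℚ n + 1ℚ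
ℕ→ℚ-suc n = trans (cong ℕ→ℚ (ℕP.+-comm 1 n)) (ℕ→ℚ-+ n 1)

ℕ→ℚ≢0 : ∀ n → .{{ℕ.NonZero n}} → ℕ→ℚ n ≢ 0ℚ
ℕ→ℚ≢0 (suc n) e with ℤ→ℚ-injective {+ suc n} {+ 0} e
... | ()

-- Cancellation and division in ℚ.

*-cancelʳ : ∀ {x y z} → z ≢ 0ℚ → x * z ≡ y * z → x ≡ y
*-cancelʳ {x} {y} {z} z≢0 e = begin
  x             ≡⟨ expand x ⟩
  x * z * w     ≡⟨ cong (_* w) e ⟩
  y * z * w     ≡⟨ sym (expand y) ⟩
  y             ∎
  where
  instance z-nonZero : ℚ.NonZero z
  z-nonZero = ℚ.≢-nonZero z≢0
  w : ℚ
  w = ℚ.1/ z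
  expand : ∀ t → t ≡ t * z * w
  expand t = sym (trans (ℚP.*-assoc t z w) (trans (cong (t *_) (ℚP.*-inverseʳ z)) (ℚP.*-identityʳ t)))

div-* : ∀ x {y} → y ≢ 0ℚ → (x div y) * y ≡ x
div-* x {y} y≢0 with y ℚP.≟ 0ℚ
... | yes y≡0 = contradiction y≡0 y≢0
... | no  y≢0′ = begin
  x * (ℚ.1/ y) * y    ≡⟨ ℚP.*-assoc x (ℚ.1/ y) y ⟩
  x * ((ℚ.1/ y) * y)  ≡⟨ cong (x *_) (ℚP.*-inverseˡ y) ⟩
  x * 1ℚ              ≡⟨ ℚP.*-identityʳ x ⟩
  x                   ∎
  where
  instance y-nonZero : ℚ.NonZero y
  y-nonZero = ℚ.≢-nonZero y≢0′

-- Binomial coefficients with rational upper argument, from their recurrence in k.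

binom-suc : ∀ a k → ℕ→ℚ (suc k) * binom a (suc k) ≡ binom a k * (a - ℕ→ℚ k)
binom-suc a k = *-cancelʳ (ℕ→ℚ≢0 (k ℕ.!) {{k ℕP.!≢0}}) (lemma
  (ℕ→ℚ (suc k)) (ℕ→ℚ (k ℕ.!)) (ℕ→ℚ (suc k ℕ.!)) (a - ℕ→ℚ k) (binom a k) (binom a (suc k)) (falling a k)
  (ℕ→ℚ-* (suc k) (k ℕ.!))
  (div-* (falling a (suc k)) (ℕ→ℚ≢0 (suc k ℕ.!) {{suc k ℕP.!≢0}}))
  (div-* (falling a k) (ℕ→ℚ≢0 (k ℕ.!) {{k ℕP.!≢0}})))
  where
  lemma : ∀ n f g d B B′ F → g ≡ n * f → B′ * g ≡ F * d → B * f ≡ F → n * B′ * f ≡ B * d * f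
  lemma n f g d B B′ F e₁ e₂ e₃ = combine₃ (- B′) 1ℚ (- d) e₁ e₂ e₃
    (solve (n ∷ f ∷ g ∷ d ∷ B ∷ B′ ∷ F ∷ []) ℚ-ring)

-- Both sides obey the same recurrence in k, by `binom-suc` at b + 1 and at b.
binom-absorb : ∀ b k → ℕ→ℚ (suc k) * binom (b + 1ℚ) (suc k) ≡ (b + 1ℚ) * binom b k
binom-absorb b zero = trans (binom-suc (b + 1ℚ) 0) (lemma b)
  where
  lemma : ∀ b → 1ℚ * (b + 1ℚ - 0ℚ) ≡ (b + 1ℚ) * 1ℚ
  lemma b = solve (b ∷ []) ℚ-ring
binom-absorb b (suc k) = *-cancelʳ (ℕ→ℚ≢0 (suc k)) (lemma
  (ℕ→ℚ (suc (suc k))) (ℕ→ℚ (suc k)) (ℕ→ℚ k) b (binom (b + 1ℚ) (suc (suc k))) (binom (b + 1ℚ) (suc k))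
  (binom b (suc k)) (binom b k)
  (ℕ→ℚ-suc k) (binom-suc (b + 1ℚ) (suc k)) (binom-absorb b k) (binom-suc b k))
  where
  lemma : ∀ n′ n k b B′ B X′ X → n ≡ k + 1ℚ → n′ * B′ ≡ B * (b + 1ℚ - n) → n * B ≡ (b + 1ℚ) * X →
    n * X′ ≡ X * (b - k) → n′ * B′ * n ≡ (b + 1ℚ) * X′ * n
  lemma n′ _ k b B′ B X′ X refl e₁ e₂ e₃ = combine₃ (k + 1ℚ) (b - k) (- (b + 1ℚ)) e₁ e₂ e₃
    (solve (n′ ∷ k ∷ b ∷ B′ ∷ B ∷ X′ ∷ X ∷ []) ℚ-ring)

binom-pascal : ∀ b k → binom (b + 1ℚ) (suc k) ≡ binom b k + binom b (suc k)
binom-pascal b k = *-cancelʳ (ℕ→ℚ≢0 (suc k)) (lemma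
  (ℕ→ℚ (suc k)) (ℕ→ℚ k) b (binom (b + 1ℚ) (suc k)) (binom b (suc k)) (binom b k)
  (ℕ→ℚ-suc k) (binom-absorb b k) (binom-suc b k))
  where
  lemma : ∀ n k b B X′ X → n ≡ k + 1ℚ → n * B ≡ (b + 1ℚ) * X → n * X′ ≡ X * (b - k) → B * n ≡ (X + X′) * n
  lemma _ k b B X′ X refl e₁ e₂ = combine₂ 1ℚ (- 1ℚ) e₁ e₂ (solve (k ∷ b ∷ B ∷ X′ ∷ X ∷ []) ℚ-ring)

-- The factor b stays on the left because b may be 0. This is the source of the outer factor b in
-- `altSum-recurrence`.
binom-pred : ∀ b k → b * binom (b - 1ℚ) k ≡ (b - ℕ→ℚ k) * binom b k
binom-pred b zero = lemma b
  where
  lemma : ∀ b → b * 1ℚ ≡ (b - 0ℚ) * 1ℚ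
  lemma b = solve (b ∷ []) ℚ-ring
binom-pred b (suc k) = *-cancelʳ (ℕ→ℚ≢0 (suc k)) (lemma
  (ℕ→ℚ (suc k)) (ℕ→ℚ k) b (binom (b - 1ℚ) (suc k)) (binom (b - 1ℚ) k) (binom b (suc k)) (binom b k)
  (ℕ→ℚ-suc k) (binom-suc (b - 1ℚ) k) (binom-pred b k) (binom-suc b k))
  where
  lemma : ∀ n k b V′ V X′ X → n ≡ k + 1ℚ → n * V′ ≡ V * (b - 1ℚ - k) → b * V ≡ (b - k) * X →
    n * X′ ≡ X * (b - k) → b * V′ * n ≡ (b - n) * X′ * n
  lemma _ k b V′ V X′ X refl e₁ e₂ e₃ = combine₃ b (b - 1ℚ - k) (- (b - 1ℚ - k)) e₁ e₂ e₃
    (solve (k ∷ b ∷ V′ ∷ V ∷ X′ ∷ X ∷ []) ℚ-ring)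

binom-ℕ : ∀ n k → ℕ→ℚ (n C k) ≡ binom (ℕ→ℚ n) k
binom-ℕ zero zero = refl
binom-ℕ zero (suc k) = *-cancelʳ (ℕ→ℚ≢0 (suc k)) (lemma (ℕ→ℚ (suc k)) (binom 0ℚ (suc k)) (vanish k))
  where
  lemma : ∀ n B → n * B ≡ 0ℚ → 0ℚ * n ≡ B * n
  lemma n B e = combine₁ (- 1ℚ) e (solve (n ∷ B ∷ []) ℚ-ring)
  lemma′ : ∀ n n′ B B′ → n * B ≡ 0ℚ → n′ * B′ ≡ B * (0ℚ - n) → n′ * B′ ≡ 0ℚ
  lemma′ n n′ B B′ e₁ e₂ = combine₂ (- 1ℚ) 1ℚ e₁ e₂ (solve (n ∷ n′ ∷ B ∷ B′ ∷ []) ℚ-ring)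
  -- The first factor of the falling factorial of 0 is 0, and `binom-suc` carries this zero on to
  -- every later k.
  vanish : ∀ k → ℕ→ℚ (suc k) * binom 0ℚ (suc k) ≡ 0ℚ
  vanish zero = refl
  vanish (suc k) = lemma′ (ℕ→ℚ (suc k)) (ℕ→ℚ (suc (suc k))) (binom 0ℚ (suc k)) (binom 0ℚ (suc (suc k)))
    (vanish k) (binom-suc 0ℚ (suc k))
binom-ℕ (suc n) zero = refl
binom-ℕ (suc n) (suc k) = begin
  ℕ→ℚ (suc n C suc k)                                 ≡⟨ cong ℕ→ℚ (sym (nCk+nC[k+1]≡[n+1]C[k+1] n k)) ⟩
  ℕ→ℚ (n C k ℕ.+ n C suc k)                           ≡⟨ ℕ→ℚ-+ (n C k) (n C suc k) ⟩
  ℕ→ℚ (n C k) + ℕ→ℚ (n C suc k)                       ≡⟨ cong₂ _+_ (binom-ℕ n k) (binom-ℕ n (suc k)) ⟩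
  binom (ℕ→ℚ n) k + binom (ℕ→ℚ n) (suc k)             ≡⟨ sym (binom-pascal (ℕ→ℚ n) k) ⟩
  binom (ℕ→ℚ n + 1ℚ) (suc k)                          ≡⟨ cong (λ x → binom x (suc k)) (sym (ℕ→ℚ-suc n)) ⟩
  binom (ℕ→ℚ (suc n)) (suc k)                         ∎

central : ℕ → ℚ
central m = binom (ℕ→ℚ (m ℕ.+ m)) m

-- Absorption leads from row 2m to row 2m + 1 and from there to row 2m + 2; in between, `binom-suc`
-- identifies the two equal middle entries of row 2m + 1.
central-suc : ∀ m → (ℕ→ℚ m + 1ℚ) * central (suc m) ≡ ℕ→ℚ 2 * (ℕ→ℚ 2 * ℕ→ℚ m + 1ℚ) * central m
central-suc m = trans (cong (λ x → (ℕ→ℚ m + 1ℚ) * binom x (suc m)) double) (*-cancelʳ (ℕ→ℚ≢0 (suc m)) (lemma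
  (ℕ→ℚ (suc m)) (ℕ→ℚ m) M (binom (M + 1ℚ + 1ℚ) (suc m)) (binom (M + 1ℚ) m) (binom (M + 1ℚ) (suc m)) (central m)
  (ℕ→ℚ-suc m) (ℕ→ℚ-+ m m)
  (binom-absorb (M + 1ℚ) m) (binom-suc (M + 1ℚ) m) (binom-absorb M m)))
  where
  M : ℚ
  M = ℕ→ℚ (m ℕ.+ m)
  double : ℕ→ℚ (suc m ℕ.+ suc m) ≡ M + 1ℚ + 1ℚ
  double = trans (ℕ→ℚ-suc (m ℕ.+ suc m)) (cong (_+ 1ℚ)
    (trans (cong ℕ→ℚ (ℕP.+-suc m m)) (ℕ→ℚ-suc (m ℕ.+ m))))
  lemma : ∀ n m M A B D Y → n ≡ m + 1ℚ → M ≡ m + m → n * A ≡ (M + 1ℚ + 1ℚ) * B →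
    n * D ≡ B * (M + 1ℚ - m) → n * D ≡ (M + 1ℚ) * Y →
    (m + 1ℚ) * A * n ≡ ℕ→ℚ 2 * (ℕ→ℚ 2 * m + 1ℚ) * Y * n
  lemma _ m _ A B D Y refl refl e₁ e₂ e₃ = combine₃ (m + 1ℚ) (- (ℕ→ℚ 2 * (m + 1ℚ))) (ℕ→ℚ 2 * (m + 1ℚ)) e₁ e₂ e₃
    (solve (m ∷ A ∷ B ∷ D ∷ Y ∷ []) ℚ-ring)

-- The alternating sum and its recurrence in the upper argument.

altSum : ℚ → ℕ → ℚ
altSum a n = sumTo n (λ k → binom a k * binom a k * sgn k)

-- Zeilberger's recurrence for the sum; the right-hand side is the telescoped
-- Gosper certificate, cleared of its denominators.
altSum-recurrence : ∀ b K →
  b * ((b + 1ℚ) * altSum (b + 1ℚ) (suc K) + ℕ→ℚ 4 * b * altSum (b - 1ℚ) (suc K)) ≡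
  - (sgn K * (binom b K * binom b K) *
      (ℕ→ℚ 6 * b * ℕ→ℚ K - ℕ→ℚ 2 * (ℕ→ℚ K * ℕ→ℚ K) - ℕ→ℚ 5 * (b * b) - b))
altSum-recurrence b zero = lemma b
  where
  lemma : ∀ b → b * ((b + 1ℚ) * 1ℚ + ℕ→ℚ 4 * b * 1ℚ) ≡
    - (1ℚ * (1ℚ * 1ℚ) * (ℕ→ℚ 6 * b * 0ℚ - ℕ→ℚ 2 * (0ℚ * 0ℚ) - ℕ→ℚ 5 * (b * b) - b))
  lemma b = solve (b ∷ []) ℚ-ring
altSum-recurrence b (suc K) = lemma b (ℕ→ℚ K) (ℕ→ℚ (suc K)) (sgn K)
  (altSum (b + 1ℚ) (suc K)) (altSum (b - 1ℚ) (suc K))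
  (binom b K) (binom b (suc K)) (binom (b - 1ℚ) (suc K)) (binom (b + 1ℚ) (suc K))
  (ℕ→ℚ-suc K) (binom-pascal b K) (altSum-recurrence b K) (binom-pred b (suc K)) (binom-suc b K)
  where
  lemma : ∀ b k k′ σ A B X Y W Z → k′ ≡ k + 1ℚ → Z ≡ X + Y →
    b * ((b + 1ℚ) * A + ℕ→ℚ 4 * b * B) ≡
      - (σ * (X * X) * (ℕ→ℚ 6 * b * k - ℕ→ℚ 2 * (k * k) - ℕ→ℚ 5 * (b * b) - b)) →
    b * W ≡ (b - k′) * Y → k′ * Y ≡ X * (b - k) →
    b * ((b + 1ℚ) * (A + Z * Z * - σ) + ℕ→ℚ 4 * b * (B + W * W * - σ)) ≡
      - (- σ * (Y * Y) * (ℕ→ℚ 6 * b * k′ - ℕ→ℚ 2 * (k′ * k′) - ℕ→ℚ 5 * (b * b) - b))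
  -- The first multiplier adds the induction hypothesis. The second factors the difference of the
  -- squares of b W and (b - k - 1) Y. What is left is a quadratic form in X and Y divisible by k′ Y
  -- - X (b - k), and the third is the cofactor.
  lemma b k _ σ A B X Y W _ refl refl e₁ e₂ e₃ = combine₃
    1ℚ
    (- (ℕ→ℚ 4 * σ * (b * W + (b - k - 1ℚ) * Y)))
    (- (σ * (ℕ→ℚ 2 * (k + 1ℚ - b) * Y + ℕ→ℚ 2 * (ℕ→ℚ 2 * b - k) * X)))
    e₁ e₂ e₃ (solve (b ∷ k ∷ σ ∷ A ∷ B ∷ X ∷ Y ∷ W ∷ []) ℚ-ring)

-- Denominators in lowest terms.

x*↧x≡↥x : ∀ x → x * ℕ→ℚ (↧ₙ x) ≡ ℤ→ℚ (↥ x)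
x*↧x≡↥x x@(mkℚ n d _) = ℚP.toℚᵘ-injective (ℚᵘP.≃-trans (ℚP.toℚᵘ-homo-* x (ℕ→ℚ (suc d)))
  (ℚᵘP.≃-trans (ℚᵘP.*-congˡ {toℚᵘ x} (toℚᵘ-ℤ→ℚ (+ suc d)))
    (ℚᵘP.≃-trans (*≡* (trans (ℤP.*-identityʳ (n ℤ.* + suc d)) (cong (λ e → n ℤ.* + e) (sym (ℕP.*-identityʳ (suc d))))))
      (ℚᵘP.≃-sym (toℚᵘ-ℤ→ℚ n)))))

-- Cross-multiplying the two fractions for x shows that the reduced denominator divides the reduced
-- numerator times d, and it is coprime to that numerator. So membership in ℤₚ can be tested on any
-- denominator, reduced or not.
↧-minimal : ∀ x d n → x * ℕ→ℚ d ≡ ℤ→ℚ n → ↧ₙ x ∣ d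
↧-minimal x@(mkℚ m e m⊥e) d n eq = Coprimality.coprime-divisor
  (Coprimality.sym (Coprimality.recompute m⊥e))
  (divides ℤ.∣ n ∣ (begin
    ℤ.∣ m ∣ ℕ.* d         ≡⟨ sym (ℤP.abs-* m (+ d)) ⟩
    ℤ.∣ m ℤ.* + d ∣       ≡⟨ cong ℤ.∣_∣ m*d≡n*e ⟩
    ℤ.∣ n ℤ.* + suc e ∣   ≡⟨ ℤP.abs-* n (+ suc e) ⟩
    ℤ.∣ n ∣ ℕ.* suc e     ∎))
  where
  lemma : ∀ x d e m n → x * d ≡ n → x * e ≡ m → m * d ≡ n * e
  lemma x d e m n e₁ e₂ = combine₂ e (- d) e₁ e₂ (solve (x ∷ d ∷ e ∷ m ∷ n ∷ []) ℚ-ring)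
  m*d≡n*e : m ℤ.* + d ≡ n ℤ.* + suc e
  m*d≡n*e = ℤ→ℚ-injective (begin
    ℤ→ℚ (m ℤ.* + d)           ≡⟨ ℤ→ℚ-* m (+ d) ⟩
    ℤ→ℚ m * ℕ→ℚ d             ≡⟨ lemma x (ℕ→ℚ d) (ℕ→ℚ (suc e)) (ℤ→ℚ m) (ℤ→ℚ n) eq (x*↧x≡↥x x) ⟩
    ℤ→ℚ n * ℕ→ℚ (suc e)       ≡⟨ sym (ℤ→ℚ-* n (+ suc e)) ⟩
    ℤ→ℚ (n ℤ.* + suc e)       ∎)

-- Signs and parity.

sgn-square : ∀ k → sgn k * sgn k ≡ 1ℚ
sgn-square zero = refl
sgn-square (suc k) = trans (lemma (sgn k)) (sgn-square k)
  where
  lemma : ∀ x → - x * - x ≡ x * x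
  lemma x = solve (x ∷ []) ℚ-ring

sgn-double : ∀ k → sgn (k ℕ.+ k) ≡ 1ℚ
sgn-double zero = refl
sgn-double (suc k) = trans (cong (-_ ∘ sgn) (ℕP.+-suc k k)) (trans (lemma (sgn (k ℕ.+ k))) (sgn-double k))
  where
  lemma : ∀ x → - (- x) ≡ x
  lemma x = solve (x ∷ []) ℚ-ring

parity : ∀ n → (∃ λ m → n ≡ m ℕ.+ m) ⊎ (∃ λ m → n ≡ suc (m ℕ.+ m))
parity zero = inj₁ (0 , refl)
parity (suc n) with parity n
... | inj₁ (m , refl) = inj₂ (m , refl)
... | inj₂ (m , refl) = inj₁ (suc m , cong suc (sym (ℕP.+-suc m m)))

m+m≡m*2 : ∀ m → m ℕ.+ m ≡ m ℕ.* 2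
m+m≡m*2 m = trans (cong (m ℕ.+_) (sym (ℕP.+-identityʳ m))) (ℕP.*-comm 2 m)

odd⇒suc-double : ∀ {n} → ¬ (2 ∣ n) → ∃ λ m → n ≡ suc (m ℕ.+ m)
odd⇒suc-double {n} n-odd with parity n
... | inj₁ (m , refl) = contradiction (divides m (m+m≡m*2 m)) n-odd
... | inj₂ result     = result

-- An odd difference added to the odd n would make m even. The half is returned as a successor, so
-- that the exponent (p - r)/2 - 1 of the sign becomes k itself.
odd∸odd : ∀ {m n} → ¬ (2 ∣ m) → ¬ (2 ∣ n) → n < m → ∃ λ k → m ∸ n ≡ suc k ℕ.+ suc k
odd∸odd {m} {n} m-odd n-odd n<m with odd⇒suc-double n-odd | parity (m ∸ n)
... | _ | inj₁ (zero , m∸n≡0) = contradiction n<m (ℕP.≤⇒≯ (ℕP.m∸n≡0⇒m≤n m∸n≡0))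
... | _ | inj₁ (suc k , e) = k , e
... | j , refl | inj₂ (k , e) = contradiction (divides (suc (k ℕ.+ j)) (begin
    m                                         ≡⟨ sym (ℕP.m∸n+n≡m (ℕP.<⇒≤ n<m)) ⟩
    m ∸ suc (j ℕ.+ j) ℕ.+ suc (j ℕ.+ j)       ≡⟨ cong (ℕ._+ suc (j ℕ.+ j)) e ⟩
    suc (k ℕ.+ k) ℕ.+ suc (j ℕ.+ j)           ≡⟨ rearrange k j ⟩
    suc (k ℕ.+ j) ℕ.* 2                       ∎)) m-odd
  where
  open +-*-Solver renaming (solve to solveℕ)
  rearrange : ∀ k j → suc (k ℕ.+ k) ℕ.+ suc (j ℕ.+ j) ≡ suc (k ℕ.+ j) ℕ.* 2
  rearrange = solveℕ 2 (λ k j → (con 1 :+ (k :+ k)) :+ (con 1 :+ (j :+ j)) := (con 1 :+ (k :+ j)) :* con 2) refl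

-- The local ring ℤₚ inside ℚ.

module Localisation {p : ℕ} (p-prime : Prime p) where

  P : ℚ
  P = ℕ→ℚ p

  -- A record around InZp, so that the rational can be inferred from its type.
  record Zp (x : ℚ) : Set where
    constructor zp
    field inZp : InZp p x
  open Zp

  Zp-intro : ∀ {x} d n → ¬ (p ∣ d) → x * ℕ→ℚ d ≡ ℤ→ℚ n → Zp x
  Zp-intro {x} d n p∤d e = zp λ p∣↧ → p∤d (∣-trans p∣↧ (↧-minimal x d n e))

  ∤-* : ∀ {m n} → ¬ (p ∣ m) → ¬ (p ∣ n) → ¬ (p ∣ m ℕ.* n)
  ∤-* {m} {n} p∤m p∤n p∣mn with euclidsLemma m n p-prime p∣mn
  ... | inj₁ p∣m = p∤m p∣m
  ... | inj₂ p∣n = p∤n p∣n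

  Zp-ℤ : ∀ n → Zp (ℤ→ℚ n)
  Zp-ℤ n = Zp-intro 1 n (λ p∣1 → ¬prime[1] (subst Prime (∣1⇒≡1 p∣1) p-prime)) (ℚP.*-identityʳ (ℤ→ℚ n))

  Zp-ℕ : ∀ n → Zp (ℕ→ℚ n)
  Zp-ℕ n = Zp-ℤ (+ n)

  infixl 6 _⊕_ _⊖_
  infixl 7 _⊗_

  _⊗_ : ∀ {x y} → Zp x → Zp y → Zp (x * y)
  _⊗_ {x} {y} hx hy = Zp-intro (↧ₙ x ℕ.* ↧ₙ y) (↥ x ℤ.* ↥ y) (∤-* (inZp hx) (inZp hy)) (begin
      x * y * ℕ→ℚ (↧ₙ x ℕ.* ↧ₙ y)     ≡⟨ cong (x * y *_) (ℕ→ℚ-* (↧ₙ x) (↧ₙ y)) ⟩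
      x * y * (ℕ→ℚ (↧ₙ x) * ℕ→ℚ (↧ₙ y)) ≡⟨ lemma x y _ _ _ _ (x*↧x≡↥x x) (x*↧x≡↥x y) ⟩
      ℤ→ℚ (↥ x) * ℤ→ℚ (↥ y)             ≡⟨ sym (ℤ→ℚ-* (↥ x) (↥ y)) ⟩
      ℤ→ℚ (↥ x ℤ.* ↥ y)                 ∎)
    where
    lemma : ∀ x y d e m n → x * d ≡ m → y * e ≡ n → x * y * (d * e) ≡ m * n
    lemma x y d e _ _ refl refl = solve (x ∷ y ∷ d ∷ e ∷ []) ℚ-ring

  _⊕_ : ∀ {x y} → Zp x → Zp y → Zp (x + y)
  _⊕_ {x} {y} hx hy = Zp-intro (↧ₙ x ℕ.* ↧ₙ y) (↥ x ℤ.* + ↧ₙ y ℤ.+ ↥ y ℤ.* + ↧ₙ x) (∤-* (inZp hx) (inZp hy)) (begin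
      (x + y) * ℕ→ℚ (↧ₙ x ℕ.* ↧ₙ y)                             ≡⟨ cong ((x + y) *_) (ℕ→ℚ-* (↧ₙ x) (↧ₙ y)) ⟩
      (x + y) * (ℕ→ℚ (↧ₙ x) * ℕ→ℚ (↧ₙ y))                       ≡⟨ lemma x y _ _ _ _ (x*↧x≡↥x x) (x*↧x≡↥x y) ⟩
      ℤ→ℚ (↥ x) * ℕ→ℚ (↧ₙ y) + ℤ→ℚ (↥ y) * ℕ→ℚ (↧ₙ x)           ≡⟨ cong₂ _+_ (ℤ→ℚ-* (↥ x) (+ ↧ₙ y)) (ℤ→ℚ-* (↥ y) (+ ↧ₙ x)) ⟨
      ℤ→ℚ (↥ x ℤ.* + ↧ₙ y) + ℤ→ℚ (↥ y ℤ.* + ↧ₙ x)               ≡⟨ ℤ→ℚ-+ (↥ x ℤ.* + ↧ₙ y) (↥ y ℤ.* + ↧ₙ x) ⟨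
      ℤ→ℚ (↥ x ℤ.* + ↧ₙ y ℤ.+ ↥ y ℤ.* + ↧ₙ x)                   ∎)
    where
    lemma : ∀ x y d e m n → x * d ≡ m → y * e ≡ n → (x + y) * (d * e) ≡ m * e + n * d
    lemma x y d e _ _ refl refl = solve (x ∷ y ∷ d ∷ e ∷ []) ℚ-ring

  Zp-neg : ∀ {x} → Zp x → Zp (- x)
  Zp-neg {x} hx = subst Zp (lemma x) (Zp-ℤ -[1+ 0 ] ⊗ hx)
    where
    lemma : ∀ x → - 1ℚ * x ≡ - x
    lemma x = solve (x ∷ []) ℚ-ring

  _⊖_ : ∀ {x y} → Zp x → Zp y → Zp (x - y)
  hx ⊖ hy = hx ⊕ Zp-neg hy

  Zp-sgn : ∀ k → Zp (sgn k)
  Zp-sgn zero    = Zp-ℕ 1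
  Zp-sgn (suc k) = Zp-neg (Zp-sgn k)

  -- Units, witnessed by an inverse in ℤₚ.

  Unit : ℚ → Set
  Unit u = Σ ℚ λ v → Zp v × v * u ≡ 1ℚ

  -- The inverse is d/n, whose denominator |n| is prime to p. Denominators are natural numbers, so a
  -- negative sign of n has to move to the numerator; hence the two cases of `v∈Zp`.
  Unit-intro : ∀ {u} d n → ¬ (p ∣ ℤ.∣ n ∣) → u * ℕ→ℚ d ≡ ℤ→ℚ n → Unit u
  Unit-intro {u} d n p∤n e = v , v∈Zp n w p∤n w-inverse , lemma w (ℕ→ℚ d) u (ℤ→ℚ n) e w-inverse
    where
    instance n-nonZero : ℚ.NonZero (ℤ→ℚ n)
    n-nonZero = ℚ.≢-nonZero λ n≡0 →
      p∤n (subst (λ m → p ∣ ℤ.∣ m ∣) (sym (ℤ→ℚ-injective {n} {+ 0} n≡0)) (p ∣0))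
    w v : ℚ
    w = ℚ.1/ ℤ→ℚ n
    v = w * ℕ→ℚ d
    w-inverse : w * ℤ→ℚ n ≡ 1ℚ
    w-inverse = ℚP.*-inverseˡ (ℤ→ℚ n)
    lemma : ∀ w d u n → u * d ≡ n → w * n ≡ 1ℚ → w * d * u ≡ 1ℚ
    lemma w d u n e₁ e₂ = combine₂ w 1ℚ e₁ e₂ (solve (w ∷ d ∷ u ∷ n ∷ []) ℚ-ring)
    lemma⁺ : ∀ w d n → w * n ≡ 1ℚ → w * d * n ≡ d
    lemma⁺ w d n e₁ = combine₁ d e₁ (solve (w ∷ d ∷ n ∷ []) ℚ-ring)
    lemma⁻ : ∀ w d n → w * - n ≡ 1ℚ → w * d * n ≡ - d
    lemma⁻ w d n e₁ = combine₁ (- d) e₁ (solve (w ∷ d ∷ n ∷ []) ℚ-ring)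
    v∈Zp : ∀ n w → ¬ (p ∣ ℤ.∣ n ∣) → w * ℤ→ℚ n ≡ 1ℚ → Zp (w * ℕ→ℚ d)
    v∈Zp (+ n)    w p∤n e = Zp-intro n (+ d) p∤n (lemma⁺ w (ℕ→ℚ d) (ℕ→ℚ n) e)
    v∈Zp -[1+ n ] w p∤n e = Zp-intro (suc n) (ℤ.- + d) p∤n
      (trans (lemma⁻ w (ℕ→ℚ d) (ℕ→ℚ (suc n)) e) (sym (ℤ→ℚ-neg (+ d))))

  ∤-< : ∀ n → suc n < p → ¬ (p ∣ suc n)
  ∤-< n n<p p∣n = ℕP.<⇒≱ n<p (∣⇒≤ p∣n)

  Unit-ℕ : ∀ n → suc n < p → Unit (ℕ→ℚ (suc n))
  Unit-ℕ n n<p = Unit-intro 1 (+ suc n) (∤-< n n<p) (ℚP.*-identityʳ (ℕ→ℚ (suc n)))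

  Unit-* : ∀ {x y} → Unit x → Unit y → Unit (x * y)
  Unit-* {x} {y} (v , hv , e) (w , hw , f) = v * w , hv ⊗ hw , lemma x y v w e f
    where
    lemma : ∀ x y v w → v * x ≡ 1ℚ → w * y ≡ 1ℚ → v * w * (x * y) ≡ 1ℚ
    lemma x y v w e f = combine₂ (w * y) 1ℚ e f (solve (x ∷ y ∷ v ∷ w ∷ []) ℚ-ring)

  Unit-*⁻ : ∀ {x y} → Zp x → Unit (x * y) → Unit y
  Unit-*⁻ {x} {y} hx (v , hv , e) = v * x , hv ⊗ hx , trans (ℚP.*-assoc v x y) e

  Unit⇒≢0 : ∀ {x} → Unit x → x ≢ 0ℚ
  Unit⇒≢0 (v , _ , e) refl with trans (sym (ℚP.*-zeroʳ v)) e
  ... | ()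

  -- Over the denominator of s, the numerator is congruent mod p to -(n + 1) times that denominator,
  -- a product of numbers prime to p. Both b in the induction and a in the final division are units
  -- of this shape.
  Unit-residue : ∀ n {s} → suc n < p → Zp s → Unit (P * s - ℕ→ℚ (suc n))
  Unit-residue n {s} n<p hs = Unit-intro (↧ₙ s) N
      (λ p∣N → ∤-* (∤-< n n<p) (inZp hs) (subst (p ∣_) (ℤP.abs-* (+ suc n) (+ ↧ₙ s)) (ℤD.∣⇒∣ᵤ (lemma₁ (ℤD.∣ᵤ⇒∣ p∣N)))))
      (begin
        (P * s - ℕ→ℚ (suc n)) * ℕ→ℚ (↧ₙ s)              ≡⟨ lemma₂ P s (ℕ→ℚ (suc n)) (ℕ→ℚ (↧ₙ s)) (ℤ→ℚ (↥ s)) (x*↧x≡↥x s) ⟩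
        P * ℤ→ℚ (↥ s) - ℕ→ℚ (suc n) * ℕ→ℚ (↧ₙ s)        ≡⟨ cong₂ _-_ (ℤ→ℚ-* (+ p) (↥ s)) (ℤ→ℚ-* (+ suc n) (+ ↧ₙ s)) ⟨
        ℤ→ℚ (+ p ℤ.* ↥ s) - ℤ→ℚ (+ suc n ℤ.* + ↧ₙ s)    ≡⟨ cong (λ x → ℤ→ℚ (+ p ℤ.* ↥ s) + x) (ℤ→ℚ-neg (+ suc n ℤ.* + ↧ₙ s)) ⟨
        ℤ→ℚ (+ p ℤ.* ↥ s) + ℤ→ℚ (ℤ.- (+ suc n ℤ.* + ↧ₙ s)) ≡⟨ ℤ→ℚ-+ (+ p ℤ.* ↥ s) (ℤ.- (+ suc n ℤ.* + ↧ₙ s)) ⟨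
        ℤ→ℚ N                                           ∎)
    where
    N : ℤ
    N = + p ℤ.* ↥ s ℤ.- + suc n ℤ.* + ↧ₙ s
    lemma₁ : + p ℤD.∣ N → + p ℤD.∣ + suc n ℤ.* + ↧ₙ s
    lemma₁ p∣N = subst (+ p ℤD.∣_) (ℤP.neg-involutive (+ suc n ℤ.* + ↧ₙ s))
      (ℤD.∣m⇒∣-m (ℤD.∣m+n∣m⇒∣n p∣N (ℤD.∣m⇒∣m*n (↥ s) ℤD.∣-refl)))
    lemma₂ : ∀ p s n d m → s * d ≡ m → (p * s - n) * d ≡ p * m - n * d
    lemma₂ p s n d _ refl = solve (p ∷ s ∷ n ∷ d ∷ []) ℚ-ring

  -- Congruences in ℤₚ.

  infix 4 _≈_[mod_]

  record _≈_[mod_] (x y m : ℚ) : Set where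
    constructor congruent
    field
      {quotient} : ℚ
      integral   : Zp quotient
      difference : x - y ≡ m * quotient

  -- Multiplying the difference by the inverse of u keeps the quotient integral. Most congruences
  -- below are first proved times a unit that clears the denominators, and then divided by it.
  Unit-cancel : ∀ {m u x y} → Unit u → u * x ≈ u * y [mod m ] → x ≈ y [mod m ]
  Unit-cancel {m} {u} {x} {y} (v , hv , e) (congruent {z} hz f) = congruent (hv ⊗ hz) (lemma m u v x y z e f)
    where
    lemma : ∀ m u v x y z → v * u ≡ 1ℚ → u * x - u * y ≡ m * z → x - y ≡ m * (v * z)
    lemma m u v x y z e f = combine₂ (y - x) v e f (solve (m ∷ u ∷ v ∷ x ∷ y ∷ z ∷ []) ℚ-ring)

  Unit-quotient : ∀ {u x y} → Unit u → u * x ≡ y → Zp y → Zp x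
  Unit-quotient {u} {x} (v , hv , e) refl hy = subst Zp (lemma v u x e) (hv ⊗ hy)
    where
    lemma : ∀ v u x → v * u ≡ 1ℚ → v * (u * x) ≡ x
    lemma v u x e = combine₁ x e (solve (v ∷ u ∷ x ∷ []) ℚ-ring)

  -- Binomial coefficients and the sum modulo p.

  binom-integral : ∀ {a} k → k < p → Zp a → Zp (binom a k)
  binom-integral zero        _   ha = Zp-ℕ 1
  binom-integral {a} (suc k) k<p ha = Unit-quotient (Unit-ℕ k k<p) (binom-suc a k)
    (binom-integral k (ℕP.<⇒≤ k<p) ha ⊗ (ha ⊖ Zp-ℕ k))

  -- Once k > r, the falling factorial of a = r + p t contains the factor a - r = p t, and k! is a
  -- unit since k < p. The factor enters in the step from r to r + 1 and every later step keeps it.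
  binom-vanishing : ∀ r t → Zp t → ∀ k → r < k → k < p → binom (ℕ→ℚ r + P * t) k ≈ 0ℚ [mod P ]
  binom-vanishing r t ht (suc k) (s≤s r≤k) k<p = Unit-cancel (Unit-ℕ k k<p) (split (ℕP.m≤n⇒m<n∨m≡n r≤k))
    where
    a : ℚ
    a = ℕ→ℚ r + P * t
    lemma₁ : ∀ n B′ B k P t → n * B′ ≡ B * (k + P * t - k) → n * B′ - n * 0ℚ ≡ P * (B * t)
    lemma₁ n B′ B k P t e = combine₁ 1ℚ e (solve (n ∷ B′ ∷ B ∷ k ∷ P ∷ t ∷ []) ℚ-ring)
    lemma₂ : ∀ n B′ B d P z → B - 0ℚ ≡ P * z → n * B′ ≡ B * d → n * B′ - n * 0ℚ ≡ P * (z * d)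
    lemma₂ n B′ B d P z e₁ e₂ = combine₂ d 1ℚ e₁ e₂ (solve (n ∷ B′ ∷ B ∷ d ∷ P ∷ z ∷ []) ℚ-ring)
    extend : binom a k ≈ 0ℚ [mod P ] → ℕ→ℚ (suc k) * binom a (suc k) ≈ ℕ→ℚ (suc k) * 0ℚ [mod P ]
    extend (congruent {z} hz e) = congruent (hz ⊗ (Zp-ℕ r ⊕ Zp-ℕ p ⊗ ht ⊖ Zp-ℕ k))
      (lemma₂ (ℕ→ℚ (suc k)) (binom a (suc k)) (binom a k) (a - ℕ→ℚ k) P z e (binom-suc a k))
    split : r < k ⊎ r ≡ k → ℕ→ℚ (suc k) * binom a (suc k) ≈ ℕ→ℚ (suc k) * 0ℚ [mod P ]
    split (inj₁ r<k)  = extend (binom-vanishing r t ht k r<k (ℕP.<⇒≤ k<p))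
    split (inj₂ refl) = congruent (binom-integral k (ℕP.<⇒≤ k<p) (Zp-ℕ r ⊕ Zp-ℕ p ⊗ ht) ⊗ ht)
      (lemma₁ (ℕ→ℚ (suc k)) (binom a (suc k)) (binom a k) (ℕ→ℚ k) P t (binom-suc a k))

  -- Consecutive coefficients have the ratio (p s - 1 - k)/(k + 1), which is -1 mod p.
  binom-minus-one : ∀ s → Zp s → ∀ k → k < p → binom (P * s - 1ℚ) k ≈ sgn k [mod P ]
  binom-minus-one s hs zero _ = congruent (Zp-ℕ 0) (lemma P)
    where
    lemma : ∀ P → 1ℚ - 1ℚ ≡ P * 0ℚ
    lemma P = solve (P ∷ []) ℚ-ring
  binom-minus-one s hs (suc k) k<p = Unit-cancel (Unit-ℕ k k<p) (extend (binom-minus-one s hs k (ℕP.<⇒≤ k<p)))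
    where
    b : ℚ
    b = P * s - 1ℚ
    lemma : ∀ n k B′ B σ P s z → n ≡ k + 1ℚ → B - σ ≡ P * z → n * B′ ≡ B * (P * s - 1ℚ - k) →
      n * B′ - n * - σ ≡ P * (σ * s + z * (P * s - 1ℚ - k))
    lemma _ k B′ B σ P s z refl e₁ e₂ = combine₂ (P * s - 1ℚ - k) 1ℚ e₁ e₂
      (solve (k ∷ B′ ∷ B ∷ σ ∷ P ∷ s ∷ z ∷ []) ℚ-ring)
    extend : binom b k ≈ sgn k [mod P ] → ℕ→ℚ (suc k) * binom b (suc k) ≈ ℕ→ℚ (suc k) * sgn (suc k) [mod P ]
    extend (congruent {z} hz e) = congruent (Zp-sgn k ⊗ hs ⊕ hz ⊗ (Zp-ℕ p ⊗ hs ⊖ Zp-ℕ 1 ⊖ Zp-ℕ k))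
      (lemma (ℕ→ℚ (suc k)) (ℕ→ℚ k) (binom b (suc k)) (binom b k) (sgn k) P s z (ℕ→ℚ-suc k) e (binom-suc b k))

  -- By `binom-vanishing` with r = 0 every term with 0 < k < p vanishes mod p, which leaves the term
  -- 1 at k = 0.
  altSum-multiple : ∀ s → Zp s → ∀ n → n < p → altSum (P * s) (suc n) ≈ 1ℚ [mod P ]
  altSum-multiple s hs zero _ = congruent (Zp-ℕ 0) (lemma P)
    where
    lemma : ∀ P → 1ℚ - 1ℚ ≡ P * 0ℚ
    lemma P = solve (P ∷ []) ℚ-ring
  altSum-multiple s hs (suc n) n<p =
    extend (altSum-multiple s hs n (ℕP.<⇒≤ n<p)) (binom-vanishing 0 s hs (suc n) (s≤s ℕ.z≤n) n<p)
    where
    lemma : ∀ A P y z σ B → A - 1ℚ ≡ P * y → B - 0ℚ ≡ P * z →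
      A + B * B * - σ - 1ℚ ≡ P * (y + P * z * z * - σ)
    lemma A P y z σ B e₁ e₂ = combine₂ 1ℚ (- (σ * (B + P * z))) e₁ e₂
      (solve (A ∷ P ∷ y ∷ z ∷ σ ∷ B ∷ []) ℚ-ring)
    extend : altSum (P * s) (suc n) ≈ 1ℚ [mod P ] → binom (0ℚ + P * s) (suc n) ≈ 0ℚ [mod P ] →
      altSum (P * s) (suc (suc n)) ≈ 1ℚ [mod P ]
    extend (congruent {y} hy e) (congruent {z} hz f) = congruent
      (hy ⊕ Zp-ℕ p ⊗ hz ⊗ hz ⊗ Zp-neg (Zp-sgn n))
      (lemma (altSum (P * s) (suc n)) P y z (sgn n) (binom (P * s) (suc n)) e
        (subst (λ x → binom x (suc n) - 0ℚ ≡ P * z) (ℚP.+-identityˡ (P * s)) f))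

  -- Central binomial coefficients prime to p.

  Unit-odd : ∀ m → suc m ℕ.+ suc m < p → Unit (ℕ→ℚ 2 * ℕ→ℚ m + 1ℚ)
  Unit-odd m 2m<p = subst Unit
    (trans (ℕ→ℚ-suc (m ℕ.+ m)) (trans (cong (_+ 1ℚ) (ℕ→ℚ-+ m m)) (lemma (ℕ→ℚ m))))
    (Unit-ℕ (m ℕ.+ m) (ℕP.<-trans (ℕP.n<1+n _) (subst (_< p) (cong suc (ℕP.+-suc m m)) 2m<p)))
    where
    lemma : ∀ m → m + m + 1ℚ ≡ ℕ→ℚ 2 * m + 1ℚ
    lemma m = solve (m ∷ []) ℚ-ring

  2<p : ∀ m → suc m ℕ.+ suc m < p → 2 < p
  2<p m = ℕP.≤-<-trans (s≤s (ℕP.≤-trans (s≤s ℕ.z≤n) (ℕP.m≤n+m (suc m) m)))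

  double-< : ∀ m → suc m ℕ.+ suc m < p → m ℕ.+ m < p
  double-< m = ℕP.≤-<-trans (ℕP.+-mono-≤ (ℕP.n≤1+n m) (ℕP.n≤1+n m))

  -- The right-hand side of `central-suc` is a product of units, so its left-hand factor
  -- `central (suc m)` is a unit too.
  Unit-central : ∀ m → m ℕ.+ m < p → Unit (central m)
  Unit-central zero    _    = 1ℚ , Zp-ℕ 1 , refl
  Unit-central (suc m) 2m<p = Unit-*⁻ (Zp-ℕ m ⊕ Zp-ℕ 1) (subst Unit (sym (central-suc m))
    (Unit-* (Unit-* (Unit-ℕ 1 (2<p m 2m<p)) (Unit-odd m 2m<p)) (Unit-central m (double-< m 2m<p))))

-- The congruence modulo p² for a = p s - 2m, by induction on m.

module _ {K : ℕ} (p-prime : Prime (suc K)) (K-even : sgn K ≡ 1ℚ) {s : ℚ} where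
  open Localisation p-prime

  a[_] : ℕ → ℚ
  a[ m ] = P * s - ℕ→ℚ 2 * ℕ→ℚ m

  -- The case K = p - 1 of `altSum-recurrence`, where the sign is 1 as p is odd. The neighbours of b
  -- enter through equations, so that they can keep the form p s - 2m.
  recurrence : ∀ {a n} b → a ≡ b - 1ℚ → n ≡ b + 1ℚ →
    b * (n * altSum n (suc K) + ℕ→ℚ 4 * b * altSum a (suc K)) ≡
    - (1ℚ * (binom b K * binom b K) *
        (ℕ→ℚ 6 * b * ℕ→ℚ K - ℕ→ℚ 2 * (ℕ→ℚ K * ℕ→ℚ K) - ℕ→ℚ 5 * (b * b) - b))
  recurrence b refl refl = trans (altSum-recurrence b K) (cong (λ σ → - (σ * (binom b K * binom b K) *
    (ℕ→ℚ 6 * b * ℕ→ℚ K - ℕ→ℚ 2 * (ℕ→ℚ K * ℕ→ℚ K) - ℕ→ℚ 5 * (b * b) - b))) K-even)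

  -- The divisor a C(2m, m) stands on the left, so that the induction involves no division. The case
  -- m = 1 is separate because here C(b, p - 1) is 1 mod p instead of 0.
  altSum-mod-p²-base : Zp s → 2 < suc K →
    a[ 1 ] * central 1 * altSum a[ 1 ] (suc K) ≈ 1ℚ * (ℕ→ℚ 2 * (P * (s - 1ℚ))) [mod P * P ]
  altSum-mod-p²-base hs 2<p = Unit-cancel
      (Unit-* (Unit-* (Unit-ℕ 1 2<p) (Unit-ℕ 1 2<p)) (Unit-* Unit-b Unit-b))
      (expand (altSum-multiple s hs K (ℕP.n<1+n K)) (binom-minus-one s hs K (ℕP.n<1+n K)))
    where
    b : ℚ
    b = P * s - 1ℚ
    hP : Zp P
    hP = Zp-ℕ (suc K)
    Unit-b : Unit b
    Unit-b = Unit-residue 0 (ℕP.<⇒≤ 2<p) hs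
    b-pred : ∀ x → x - ℕ→ℚ 2 * 1ℚ ≡ x - 1ℚ - 1ℚ
    b-pred x = solve (x ∷ []) ℚ-ring
    b-suc : ∀ x → x ≡ x - 1ℚ + 1ℚ
    b-suc x = solve (x ∷ []) ℚ-ring
    -- For b = p s - 1 the polynomial q(b) equals p (3s - 2 + p (6s - 2 - 5s²)). With C and U both 1
    -- mod p the recurrence gives 4 b² S ≡ -2p (s - 1) mod p². After multiplication by 2a the sides
    -- differ by -4p (s - 1)(a + 2b²), and p divides a + 2b². The quotient collects these multiples
    -- of p².
    lemma : ∀ P k s u z S U C → P ≡ k + 1ℚ → U ≡ 1ℚ + P * u → C ≡ 1ℚ + P * z →
      (P * s - 1ℚ) * (P * s * U + ℕ→ℚ 4 * (P * s - 1ℚ) * S) ≡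
      - (1ℚ * (C * C) *
          (ℕ→ℚ 6 * (P * s - 1ℚ) * k - ℕ→ℚ 2 * (k * k) - ℕ→ℚ 5 * ((P * s - 1ℚ) * (P * s - 1ℚ)) - (P * s - 1ℚ))) →
      ℕ→ℚ 2 * ℕ→ℚ 2 * ((P * s - 1ℚ) * (P * s - 1ℚ)) * ((P * s - ℕ→ℚ 2 * 1ℚ) * ℕ→ℚ 2 * S) -
      ℕ→ℚ 2 * ℕ→ℚ 2 * ((P * s - 1ℚ) * (P * s - 1ℚ)) * (1ℚ * (ℕ→ℚ 2 * (P * (s - 1ℚ)))) ≡
      P * P * (ℕ→ℚ 2 * (P * s - ℕ→ℚ 2) *
        (ℕ→ℚ 5 * s * s + ℕ→ℚ 2 - ℕ→ℚ 6 * s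
          - (ℕ→ℚ 3 * s - ℕ→ℚ 2 + P * (ℕ→ℚ 6 * s - ℕ→ℚ 2 - ℕ→ℚ 5 * s * s)) * (ℕ→ℚ 2 * z + P * z * z)
          - s * s - (P * s - 1ℚ) * s * u)
      + ℕ→ℚ 4 * s * (1ℚ - s) - ℕ→ℚ 8 * (s - 1ℚ) * (P * s * s - ℕ→ℚ 2 * s))
    lemma _ k s u z S _ _ refl refl refl e = combine₁ (ℕ→ℚ 2 * ((k + 1ℚ) * s - ℕ→ℚ 2)) e
      (solve (k ∷ s ∷ u ∷ z ∷ S ∷ []) ℚ-ring)
    expand : altSum (P * s) (suc K) ≈ 1ℚ [mod P ] → binom b K ≈ sgn K [mod P ] →
      ℕ→ℚ 2 * ℕ→ℚ 2 * (b * b) * (a[ 1 ] * central 1 * altSum a[ 1 ] (suc K)) ≈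
      ℕ→ℚ 2 * ℕ→ℚ 2 * (b * b) * (1ℚ * (ℕ→ℚ 2 * (P * (s - 1ℚ)))) [mod P * P ]
    expand (congruent {u} hu e) (congruent {z} hz f) = congruent
      (Zp-ℕ 2 ⊗ (hP ⊗ hs ⊖ Zp-ℕ 2) ⊗
          (Zp-ℕ 5 ⊗ hs ⊗ hs ⊕ Zp-ℕ 2 ⊖ Zp-ℕ 6 ⊗ hs
            ⊖ (Zp-ℕ 3 ⊗ hs ⊖ Zp-ℕ 2 ⊕ hP ⊗ (Zp-ℕ 6 ⊗ hs ⊖ Zp-ℕ 2 ⊖ Zp-ℕ 5 ⊗ hs ⊗ hs)) ⊗ (Zp-ℕ 2 ⊗ hz ⊕ hP ⊗ hz ⊗ hz)
            ⊖ hs ⊗ hs ⊖ (hP ⊗ hs ⊖ Zp-ℕ 1) ⊗ hs ⊗ hu)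
        ⊕ Zp-ℕ 4 ⊗ hs ⊗ (Zp-ℕ 1 ⊖ hs) ⊖ Zp-ℕ 8 ⊗ (hs ⊖ Zp-ℕ 1) ⊗ (hP ⊗ hs ⊗ hs ⊖ Zp-ℕ 2 ⊗ hs))
      (lemma P (ℕ→ℚ K) s u z (altSum a[ 1 ] (suc K)) (altSum (P * s) (suc K)) (binom b K)
        (ℕ→ℚ-suc K) (minuend (altSum (P * s) (suc K)) 1ℚ e) (minuend (binom b K) 1ℚ (subst (λ σ → binom b K - σ ≡ P * z) K-even f))
        (recurrence b (b-pred (P * s)) (b-suc (P * s))))

  -- The residue of b = (p - 1 - 2m) + p (s - 1) is below p - 1 because m > 0. Hence p divides C(b,
  -- p - 1) and its square drops out of the recurrence mod p².
  altSum-mod-p²-step : Zp s → ∀ m k → suc m ℕ.+ suc m < suc K → 0 < m →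
    a[ m ] * central m * altSum a[ m ] (suc K) ≈ sgn k * (ℕ→ℚ 2 * (P * (s - 1ℚ))) [mod P * P ] →
    a[ suc m ] * central (suc m) * altSum a[ suc m ] (suc K) ≈ - sgn k * (ℕ→ℚ 2 * (P * (s - 1ℚ))) [mod P * P ]
  altSum-mod-p²-step hs m k 2m+2<p 0<m IH = Unit-cancel
      (Unit-* (Unit-* (Unit-ℕ 1 (2<p m 2m+2<p)) (Unit-ℕ 1 (2<p m 2m+2<p)))
        (Unit-* (Unit-* Unit-b Unit-b) (Unit-ℕ m (ℕP.≤-<-trans (ℕP.m≤m+n (suc m) (suc m)) 2m+2<p))))
      (extend IH (binom-vanishing (K ∸ (m ℕ.+ m)) (s - 1ℚ) (hs ⊖ Zp-ℕ 1) K
        (ℕP.∸-monoʳ-< (ℕP.≤-trans 0<m (ℕP.m≤m+n m m)) 2m≤K) (ℕP.n<1+n K)))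
    where
    μ σ b q : ℚ
    μ = ℕ→ℚ m
    σ = sgn k
    b = P * s - ℕ→ℚ 2 * μ - 1ℚ
    q = ℕ→ℚ 6 * b * ℕ→ℚ K - ℕ→ℚ 2 * (ℕ→ℚ K * ℕ→ℚ K) - ℕ→ℚ 5 * (b * b) - b
    2m≤K : m ℕ.+ m ≤ K
    2m≤K = ℕP.<⇒≤pred (double-< m 2m+2<p)
    b≡Ps-[2m+1] : P * s - ℕ→ℚ (suc (m ℕ.+ m)) ≡ b
    b≡Ps-[2m+1] = lemma (P * s) μ (ℕ→ℚ (m ℕ.+ m)) (ℕ→ℚ (suc (m ℕ.+ m))) (ℕ→ℚ-suc (m ℕ.+ m)) (ℕ→ℚ-+ m m)
      where
      lemma : ∀ x μ M N → N ≡ M + 1ℚ → M ≡ μ + μ → x - N ≡ x - ℕ→ℚ 2 * μ - 1ℚ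
      lemma x μ _ _ refl refl = solve (x ∷ μ ∷ []) ℚ-ring
    b-residue : ℕ→ℚ (K ∸ (m ℕ.+ m)) + P * (s - 1ℚ) ≡ b
    b-residue = lemma P s μ (ℕ→ℚ K) (ℕ→ℚ (m ℕ.+ m)) (ℕ→ℚ (K ∸ (m ℕ.+ m))) (ℕ→ℚ-suc K) (ℕ→ℚ-+ m m)
        (trans (cong ℕ→ℚ (sym (ℕP.m∸n+n≡m 2m≤K))) (ℕ→ℚ-+ (K ∸ (m ℕ.+ m)) (m ℕ.+ m)))
      where
      lemma : ∀ P s μ k M r → P ≡ k + 1ℚ → M ≡ μ + μ → k ≡ r + M → r + P * (s - 1ℚ) ≡ P * s - ℕ→ℚ 2 * μ - 1ℚ
      lemma _ s μ _ _ r refl refl refl = solve (s ∷ μ ∷ r ∷ []) ℚ-ring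
    Unit-b : Unit b
    Unit-b = subst Unit b≡Ps-[2m+1] (Unit-residue (m ℕ.+ m)
      (ℕP.<-trans (ℕP.n<1+n _) (subst (_< suc K) (cong suc (ℕP.+-suc m m)) 2m+2<p)) hs)
    hb : Zp b
    hb = Zp-ℕ (suc K) ⊗ hs ⊖ Zp-ℕ 2 ⊗ Zp-ℕ m ⊖ Zp-ℕ 1
    hq : Zp q
    hq = Zp-ℕ 6 ⊗ hb ⊗ Zp-ℕ K ⊖ Zp-ℕ 2 ⊗ (Zp-ℕ K ⊗ Zp-ℕ K) ⊖ Zp-ℕ 5 ⊗ (hb ⊗ hb) ⊖ hb
    b-pred : ∀ x μ n → n ≡ μ + 1ℚ → x - ℕ→ℚ 2 * n ≡ x - ℕ→ℚ 2 * μ - 1ℚ - 1ℚ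
    b-pred x μ _ refl = solve (x ∷ μ ∷ []) ℚ-ring
    b-suc : ∀ x μ → x - ℕ→ℚ 2 * μ ≡ x - ℕ→ℚ 2 * μ - 1ℚ + 1ℚ
    b-suc x μ = solve (x ∷ μ ∷ []) ℚ-ring
    certificate : ∀ P z C q → C - 0ℚ ≡ P * z → - (1ℚ * (C * C) * q) ≡ P * P * - (z * z * q)
    certificate P z C q e = combine₁ (- ((C + P * z) * q)) e (solve (P ∷ z ∷ C ∷ q ∷ []) ℚ-ring)
    lemma : ∀ P s μ n σ Y Y′ S S′ y w → n ≡ μ + 1ℚ →
      (P * s - ℕ→ℚ 2 * μ) * Y * S - σ * (ℕ→ℚ 2 * (P * (s - 1ℚ))) ≡ P * P * y →
      (P * s - ℕ→ℚ 2 * μ - 1ℚ) * ((P * s - ℕ→ℚ 2 * μ) * S + ℕ→ℚ 4 * (P * s - ℕ→ℚ 2 * μ - 1ℚ) * S′) ≡ P * P * w →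
      (μ + 1ℚ) * Y′ ≡ ℕ→ℚ 2 * (ℕ→ℚ 2 * μ + 1ℚ) * Y →
      ℕ→ℚ 2 * ℕ→ℚ 2 * ((P * s - ℕ→ℚ 2 * μ - 1ℚ) * (P * s - ℕ→ℚ 2 * μ - 1ℚ) * n)
        * ((P * s - ℕ→ℚ 2 * n) * Y′ * S′)
      - ℕ→ℚ 2 * ℕ→ℚ 2 * ((P * s - ℕ→ℚ 2 * μ - 1ℚ) * (P * s - ℕ→ℚ 2 * μ - 1ℚ) * n)
        * (- σ * (ℕ→ℚ 2 * (P * (s - 1ℚ)))) ≡
      P * P * (ℕ→ℚ 2 * (ℕ→ℚ 2 * μ + 1ℚ) * (P * s - ℕ→ℚ 2 * (μ + 1ℚ)) * (Y * w - (P * s - ℕ→ℚ 2 * μ - 1ℚ) * y)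
        + ℕ→ℚ 4 * σ * (P * s - ℕ→ℚ 2 * μ - 1ℚ) * s * (s - 1ℚ))
    -- The multipliers belong to the induction hypothesis, to the recurrence that trades S′ for S,
    -- and to `central-suc`, which trades Y′ for Y. The coefficients 2(2m + 1)(p s - 2m - 2) and 4 b
    -- (m + 1) that remain differ by -2p s; together with the p in 2p(s - 1) this is a multiple of
    -- p².
    lemma P s μ _ σ Y Y′ S S′ y w refl e₁ e₂ e₃ = combine₃
      (- (ℕ→ℚ 2 * (ℕ→ℚ 2 * μ + 1ℚ) * (P * s - ℕ→ℚ 2 * (μ + 1ℚ)) * (P * s - ℕ→ℚ 2 * μ - 1ℚ)))
      (ℕ→ℚ 2 * (ℕ→ℚ 2 * μ + 1ℚ) * (P * s - ℕ→ℚ 2 * (μ + 1ℚ)) * Y)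
      (ℕ→ℚ 4 * ((P * s - ℕ→ℚ 2 * μ - 1ℚ) * (P * s - ℕ→ℚ 2 * μ - 1ℚ)) * (P * s - ℕ→ℚ 2 * (μ + 1ℚ)) * S′)
      e₁ e₂ e₃ (solve (P ∷ s ∷ μ ∷ σ ∷ Y ∷ Y′ ∷ S ∷ S′ ∷ y ∷ w ∷ []) ℚ-ring)
    extend : a[ m ] * central m * altSum a[ m ] (suc K) ≈ σ * (ℕ→ℚ 2 * (P * (s - 1ℚ))) [mod P * P ] →
      binom (ℕ→ℚ (K ∸ (m ℕ.+ m)) + P * (s - 1ℚ)) K ≈ 0ℚ [mod P ] →
      ℕ→ℚ 2 * ℕ→ℚ 2 * (b * b * ℕ→ℚ (suc m)) * (a[ suc m ] * central (suc m) * altSum a[ suc m ] (suc K)) ≈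
      ℕ→ℚ 2 * ℕ→ℚ 2 * (b * b * ℕ→ℚ (suc m)) * (- σ * (ℕ→ℚ 2 * (P * (s - 1ℚ)))) [mod P * P ]
    extend (congruent {y} hy e) (congruent {z} hz f) = congruent
      (Zp-ℕ 2 ⊗ (Zp-ℕ 2 ⊗ Zp-ℕ m ⊕ Zp-ℕ 1) ⊗ (Zp-ℕ (suc K) ⊗ hs ⊖ Zp-ℕ 2 ⊗ (Zp-ℕ m ⊕ Zp-ℕ 1))
          ⊗ (binom-integral m (ℕP.≤-<-trans (ℕP.≤-trans (ℕP.m≤m+n m m) 2m≤K) (ℕP.n<1+n K)) (Zp-ℕ (m ℕ.+ m))
               ⊗ Zp-neg (hz ⊗ hz ⊗ hq)
             ⊖ hb ⊗ hy)
        ⊕ Zp-ℕ 4 ⊗ Zp-sgn k ⊗ hb ⊗ hs ⊗ (hs ⊖ Zp-ℕ 1))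
      (lemma P s μ (ℕ→ℚ (suc m)) σ (central m) (central (suc m)) (altSum a[ m ] (suc K)) (altSum a[ suc m ] (suc K))
        y (- (z * z * q)) (ℕ→ℚ-suc m) e
        (trans (recurrence b (b-pred (P * s) μ (ℕ→ℚ (suc m)) (ℕ→ℚ-suc m)) (b-suc (P * s) μ))
          (certificate P z (binom b K) q (subst (λ x → binom x K - 0ℚ ≡ P * z) b-residue f)))
        (central-suc m))

  -- Counting from i = m - 1 turns the sign (-1)^(m - 1) into `sgn i`.
  altSum-mod-p² : Zp s → ∀ i → suc i ℕ.+ suc i < suc K →
    a[ suc i ] * central (suc i) * altSum a[ suc i ] (suc K) ≈ sgn i * (ℕ→ℚ 2 * (P * (s - 1ℚ))) [mod P * P ]
  altSum-mod-p² hs zero    2m<p = altSum-mod-p²-base hs 2m<p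
  altSum-mod-p² hs (suc i) 2m<p = altSum-mod-p²-step hs (suc i) i 2m<p (s≤s ℕ.z≤n)
    (altSum-mod-p² hs i (double-< (suc i) 2m<p))

-- From p s - 2m back to a and its residue r.

module _ {K : ℕ} (p-prime : Prime (suc K)) where
  open Localisation p-prime

  -- From a = r + p t and p = 2m + r follows a = p (t + 1) - 2m, so s = t + 1 and p (s - 1) = a - r.
  -- The divisor a C(2m, m) is a unit and can be brought back to the right.
  altSum-congruence : sgn K ≡ 1ℚ → ∀ {a t} r i →
    Zp t → a - ℕ→ℚ r ≡ P * t → suc K ≡ suc i ℕ.+ suc i ℕ.+ r → suc i ℕ.+ suc i < suc K →
    altSum a (suc K) ≈
      sgn i * ((ℕ→ℚ 2 * (a - ℕ→ℚ r)) div (a * ℕ→ℚ ((suc i ℕ.+ suc i) C suc i))) [mod P * P ]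
  altSum-congruence K-even {a} {t} r i t∈Zp a-r≡Pt p≡2m+r 2m<p =
    subst (λ c → altSum a (suc K) ≈ sgn i * ((ℕ→ℚ 2 * (a - ℕ→ℚ r)) div (a * c)) [mod P * P ])
      (sym (binom-ℕ (m ℕ.+ m) m))
      (Unit-cancel Unit-divisor (divide (altSum-mod-p² p-prime K-even s∈Zp i 2m<p)))
    where
    m : ℕ
    m = suc i
    s Q : ℚ
    s = t + 1ℚ
    Q = (ℕ→ℚ 2 * (a - ℕ→ℚ r)) div (a * central m)
    s∈Zp : Zp s
    s∈Zp = t∈Zp ⊕ Zp-ℕ 1
    Ps-2m≡a : P * s - ℕ→ℚ (m ℕ.+ m) ≡ a
    Ps-2m≡a = lemma P t a (ℕ→ℚ r) (ℕ→ℚ (m ℕ.+ m)) (trans (cong ℕ→ℚ p≡2m+r) (ℕ→ℚ-+ (m ℕ.+ m) r)) a-r≡Pt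
      where
      lemma : ∀ P t a r M → P ≡ M + r → a - r ≡ P * t → P * (t + 1ℚ) - M ≡ a
      lemma P t a r M e₁ e₂ = combine₂ 1ℚ (- 1ℚ) e₁ e₂ (solve (P ∷ t ∷ a ∷ r ∷ M ∷ []) ℚ-ring)
    a[m]≡a : P * s - ℕ→ℚ 2 * ℕ→ℚ m ≡ a
    a[m]≡a = trans (lemma (P * s) (ℕ→ℚ m) (ℕ→ℚ (m ℕ.+ m)) (ℕ→ℚ-+ m m)) Ps-2m≡a
      where
      lemma : ∀ x μ M → M ≡ μ + μ → x - ℕ→ℚ 2 * μ ≡ x - M
      lemma x μ _ refl = solve (x ∷ μ ∷ []) ℚ-ring
    Unit-divisor : Unit (a * central m)
    Unit-divisor = Unit-* (subst Unit Ps-2m≡a (Unit-residue (i ℕ.+ m) 2m<p s∈Zp)) (Unit-central m 2m<p)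
    lemma : ∀ P t D S σ d Q z → d ≡ P * t → Q * D ≡ ℕ→ℚ 2 * d →
      D * S - σ * (ℕ→ℚ 2 * (P * (t + 1ℚ - 1ℚ))) ≡ P * P * z → D * S - D * (σ * Q) ≡ P * P * z
    lemma P t D S σ d Q z e₁ e₂ e₃ = combine₃ (- (σ * ℕ→ℚ 2)) (- σ) 1ℚ e₁ e₂ e₃
      (solve (P ∷ t ∷ D ∷ S ∷ σ ∷ d ∷ Q ∷ z ∷ []) ℚ-ring)
    divide : (P * s - ℕ→ℚ 2 * ℕ→ℚ m) * central m * altSum (P * s - ℕ→ℚ 2 * ℕ→ℚ m) (suc K) ≈
        sgn i * (ℕ→ℚ 2 * (P * (s - 1ℚ))) [mod P * P ] →
      a * central m * altSum a (suc K) ≈ a * central m * (sgn i * Q) [mod P * P ]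
    divide (congruent {z} hz e) = congruent hz (lemma P t (a * central m) (altSum a (suc K)) (sgn i)
      (a - ℕ→ℚ r) Q z a-r≡Pt (div-* (ℕ→ℚ 2 * (a - ℕ→ℚ r)) (Unit⇒≢0 Unit-divisor))
      (subst (λ x → x * central m * altSum x (suc K) - sgn i * (ℕ→ℚ 2 * (P * (s - 1ℚ))) ≡ P * P * z) a[m]≡a e))

-- Passage from p - r to its half m, and the congruence with modulus `p ^ 2`.

theorem3p1 : (p : ℕ) → Prime p → ¬ (2 ∣ p) →
    (a : ℚ) → InZp p a →
    (r : ℕ) → r < p → Cong p (ℕ→ℚ p) a (ℕ→ℚ r) → ¬ (2 ∣ r) →
    Cong p (ℕ→ℚ (p ^ 2))
    (sumTo p (λ k → binom a k * binom a k * sgn k))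
    (sgn ((p ∸ r) / 2 ∸ 1) * ((ℕ→ℚ 2 * (a - ℕ→ℚ r)) div (a * ℕ→ℚ ((p ∸ r) C ((p ∸ r) / 2)))))
theorem3p1 zero p-prime = contradiction p-prime ¬prime[0]
theorem3p1 (suc K) p-prime p-odd a _ r r<p (t , t∈Zp , a-r≡Pt) r-odd =
  conclude (odd∸odd p-odd r-odd r<p)
  where
  open Localisation p-prime
  K-even : sgn K ≡ 1ℚ
  K-even = even (odd⇒suc-double p-odd)
    where
    even : (∃ λ j → suc K ≡ suc (j ℕ.+ j)) → sgn K ≡ 1ℚ
    even (j , p≡1+2j) = trans (cong sgn (ℕP.suc-injective p≡1+2j)) (sgn-double j)
  -- An odd r is positive, which gives 2m = p - r < p, the bound that makes a and C(2m, m) units.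
  0<r : 0 < r
  0<r = ℕP.n≢0⇒n>0 λ r≡0 → r-odd (subst (2 ∣_) (sym r≡0) (2 ∣0))
  -- Here x and h stand for p - r and its half; as variables they can be replaced by 2m and m
  -- through matching on `refl`.
  expand : ∀ {x h i} → x ≡ suc i ℕ.+ suc i → h ≡ suc i →
    altSum a (suc K) ≈ sgn i * ((ℕ→ℚ 2 * (a - ℕ→ℚ r)) div (a * ℕ→ℚ ((suc i ℕ.+ suc i) C suc i))) [mod P * P ] →
    Cong (suc K) (ℕ→ℚ (suc K ^ 2)) (altSum a (suc K))
      (sgn (h ∸ 1) * ((ℕ→ℚ 2 * (a - ℕ→ℚ r)) div (a * ℕ→ℚ (x C h))))
  expand refl refl (congruent {z} hz e) = z , Zp.inZp hz , trans e (cong (_* z) P*P≡p^2)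
    where
    P*P≡p^2 : P * P ≡ ℕ→ℚ (suc K ^ 2)
    P*P≡p^2 = trans (sym (ℕ→ℚ-* (suc K) (suc K))) (cong (λ n → ℕ→ℚ (suc K ℕ.* n)) (sym (ℕP.*-identityʳ (suc K))))
  conclude : (∃ λ i → suc K ∸ r ≡ suc i ℕ.+ suc i) →
    Cong (suc K) (ℕ→ℚ (suc K ^ 2)) (altSum a (suc K))
      (sgn ((suc K ∸ r) / 2 ∸ 1) * ((ℕ→ℚ 2 * (a - ℕ→ℚ r)) div (a * ℕ→ℚ ((suc K ∸ r) C ((suc K ∸ r) / 2)))))
  conclude (i , p∸r≡2m) = expand p∸r≡2m
    (trans (cong (_/ 2) (trans p∸r≡2m (m+m≡m*2 (suc i)))) (m*n/n≡m (suc i) 2))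
    (altSum-congruence p-prime K-even r i (zp t∈Zp) a-r≡Pt
      (trans (sym (ℕP.m∸n+n≡m (ℕP.<⇒≤ r<p))) (cong (ℕ._+ r) p∸r≡2m))
      (subst (_< suc K) p∸r≡2m (ℕP.∸-monoʳ-< {suc K} {r} {0} 0<r (ℕP.<⇒≤ r<p))))
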